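{- Let $F\subset\mathbb{C}$ be a field and let $\Gamma$ be a finitely generated subgroup of $F^*$ with $-1\in\Gamma$. Let $R$ be a subring of $F$ which is generated as a $\mathbb{Z}$-module by a finite set $\mathcal{E}\subset\Gamma\cap R$. Let $n\geq I\geq 2$ be integers and assume that the equation $$u_1+\dots+u_I=n,\qquad u_1,\dots,u_I\in\Gamma\cap R$$ has a solution $(u_1,\dots,u_I)\neq(1,\dots,1)$. Then $\omega_\Gamma(R)\leq n-1$; that is, every nonzero $\alpha\in R$ can be written as $\alpha=a_1\nu_1+\dots+a_\ell\nu_\ell$ with pairwise distinct $\nu_1,\dots,\nu_\ell\in\Gamma\cap R$ and integers $a_1,\dots,a_\ell\in\{1,\dots,n-1\}$.
   Context: Let $F$ be a field of characteristic $0$, $\Gamma$ a finitely generated subgroup of $F^*$ and $R\subset F$ a subring. For $\alpha\in R$, if $\alpha$ can be written as $\alpha=a_1\nu_1+\dots+a_\ell\nu_\ell$ with pairwise distinct $\nu_1,\dots,\nu_\ell\in\Gamma\cap R$ and integers $a_1\geq\dots\geq a_\ell>0$, the $R$-$\Gamma$-unit sum height $\omega_{R,\Gamma}(\alpha)$ is the smallest possible value of $a_1$ over all such representations; $\omega_{R,\Gamma}(0)=0$, and $\omega_{R,\Gamma}(\alpha)=\infty$ if no such representation exists. Then $\omega_\Gamma(R)=\max\{\omega_{R,\Gamma}(\alpha):\alpha\in R\}$ if this maximum exists; otherwise $\omega_\Gamma(R)=\omega$ if all $\omega_{R,\Gamma}(\alpha)<\infty$, and $\omega_\Gamma(R)=\infty$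 if some $\omega_{R,\Gamma}(\alpha)=\infty$. -}

module Defs where

open import Level using (0ℓ; _⊔_) renaming (suc to lsuc)
open import Algebra.Bundles using (AbelianGroup; CommutativeRing)
import Algebra.Consequences.Setoid as Consequences
import Algebra.Construct.DirectProduct as DirectProduct
import Algebra.Definitions.RawMonoid as RawMonoidDefinitions
import Algebra.Properties.CommutativeSemigroup as CommutativeSemigroupProperties
import Algebra.Properties.Ring as RingProperties
open import Data.Fin.Base using (zero) renaming (_≤_ to _≤ᶠ_)
open import Data.Integer.Base using (ℤ; +_; -[1+_])
open import Data.Nat.Base using (ℕ; suc; _≤_; _<_)
open import Data.Product.Base using (_×_; _,_; ∃-syntax; Σ-syntax)
open import Data.Vec.Functional using (Vector)
open import Function.Definitions using (Injective)
open import Relation.Binary.Core using (Rel)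
open import Relation.Binary.Definitions using (_Respects_)
open import Relation.Binary.PropositionalEquality using (_≡_)
open import Relation.Binary.Structures using (IsTotalOrder)
open import Relation.Nullary.Negation using (¬_)
open import Relation.Unary using (Pred; _∈_; _⊆_; _∩_; _≐_)

-- ℝ is characterised, up to isomorphism, as a complete ordered field.

record CompleteOrderedField c ℓ₁ ℓ₂ : Set (lsuc (c ⊔ ℓ₁ ⊔ ℓ₂)) where
  infix 4 _≼_
  field
    commutativeRing : CommutativeRing c ℓ₁
  open CommutativeRing commutativeRing public
  field
    1≉0           : ¬ 1# ≈ 0#
    inverse       : ∀ x → ¬ x ≈ 0# → ∃[ y ] x * y ≈ 1#
    _≼_           : Rel Carrier ℓ₂
    isTotalOrder  : IsTotalOrder _≈_ _≼_
    +-monoʳ-≼     : ∀ x {y z} → y ≼ z → x + y ≼ x + z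
    *-nonNegative : ∀ {x y} → 0# ≼ x → 0# ≼ y → 0# ≼ x * y

  UpperBound : Pred Carrier (c ⊔ ℓ₁ ⊔ ℓ₂) → Pred Carrier (c ⊔ ℓ₁ ⊔ ℓ₂)
  UpperBound P b = ∀ x → x ∈ P → x ≼ b

  field
    supremum : ∀ P → ∃[ x ] x ∈ P → ∃[ b ] b ∈ UpperBound P →
               ∃[ s ] s ∈ UpperBound P × (∀ b → b ∈ UpperBound P → s ≼ b)

-- K [i] = K[X]/(X² + 1), with (a , b) standing for a + bi.

module _ {c ℓ} (K : CommutativeRing c ℓ) where
  private
    open CommutativeRing K
    open CommutativeSemigroupProperties +-commutativeSemigroup
      using (interchange)
    open RingProperties ring
      using (-‿+-comm; -0#≈0#; x[y-z]≈xy-xz; [y-z]x≈yx-zx)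
    open import Relation.Binary.Reasoning.Setoid setoid

    module K² = AbelianGroup
      (DirectProduct.abelianGroup +-abelianGroup +-abelianGroup)

    mul : K².Carrier → K².Carrier → K².Carrier
    mul (a , b) (c , d) = a * c - b * d , a * d + b * c

    one : K².Carrier
    one = 1# , 0#

    mul-cong : ∀ {x x′ y y′} → x K².≈ x′ → y K².≈ y′ → mul x y K².≈ mul x′ y′
    mul-cong (a≈ , b≈) (c≈ , d≈) =
      +-cong (*-cong a≈ c≈) (-‿cong (*-cong b≈ d≈)) ,
      +-cong (*-cong a≈ d≈) (*-cong b≈ c≈)

    mul-comm : ∀ x y → mul x y K².≈ mul y x
    mul-comm (a , b) (c , d) =
      +-cong (*-comm a c) (-‿cong (*-comm b d)) ,
      trans (+-comm (a * d) (b * c)) (+-cong (*-comm b c) (*-comm a d))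

    mul-identityˡ : ∀ x → mul one x K².≈ x
    mul-identityˡ (a , b) =
      trans (+-cong (*-identityˡ a) (trans (-‿cong (zeroˡ b)) -0#≈0#))
            (+-identityʳ a) ,
      trans (+-cong (*-identityˡ b) (zeroˡ a)) (+-identityʳ b)

    mul-distribˡ : ∀ x y z → mul x (y K².∙ z) K².≈ mul x y K².∙ mul x z
    mul-distribˡ (a , b) (c , d) (e , f) =
      (begin
        a * (c + e) - b * (d + f)
          ≈⟨ +-cong (distribˡ a c e) (-‿cong (distribˡ b d f)) ⟩
        (a * c + a * e) - (b * d + b * f)
          ≈⟨ +-congˡ (-‿+-comm (b * d) (b * f)) ⟨
        (a * c + a * e) + (- (b * d) + - (b * f))
          ≈⟨ interchange (a * c) (a * e) (- (b * d)) (- (b * f)) ⟩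
        (a * c - b * d) + (a * e - b * f) ∎) ,
      (begin
        a * (d + f) + b * (c + e)
          ≈⟨ +-cong (distribˡ a d f) (distribˡ b c e) ⟩
        (a * d + a * f) + (b * c + b * e)
          ≈⟨ interchange (a * d) (a * f) (b * c) (b * e) ⟩
        (a * d + b * c) + (a * f + b * e) ∎)

    mul-assoc : ∀ x y z → mul (mul x y) z K².≈ mul x (mul y z)
    mul-assoc (a , b) (c , d) (e , f) =
      (begin
        (a * c - b * d) * e - (a * d + b * c) * f
          ≈⟨ +-cong ([y-z]x≈yx-zx e (a * c) (b * d))
                    (-‿cong (distribʳ f (a * d) (b * c))) ⟩
        (a * c * e - b * d * e) - (a * d * f + b * c * f)
          ≈⟨ +-congˡ (-‿+-comm (a * d * f) (b * c * f)) ⟨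
        (a * c * e - b * d * e) + (- (a * d * f) + - (b * c * f))
          ≈⟨ interchange (a * c * e) (- (b * d * e)) (- (a * d * f)) (- (b * c * f)) ⟩
        (a * c * e - a * d * f) + (- (b * d * e) + - (b * c * f))
          ≈⟨ +-congˡ (trans (+-comm _ _) (-‿+-comm (b * c * f) (b * d * e))) ⟩
        (a * c * e - a * d * f) - (b * c * f + b * d * e)
          ≈⟨ +-cong (+-cong (*-assoc a c e) (-‿cong (*-assoc a d f)))
                    (-‿cong (+-cong (*-assoc b c f) (*-assoc b d e))) ⟩
        (a * (c * e) - a * (d * f)) - (b * (c * f) + b * (d * e))
          ≈⟨ +-cong (x[y-z]≈xy-xz a (c * e) (d * f))
                    (-‿cong (distribˡ b (c * f) (d * e))) ⟨
        a * (c * e - d * f) - b * (c * f + d * e) ∎) ,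
      (begin
        (a * c - b * d) * f + (a * d + b * c) * e
          ≈⟨ +-cong ([y-z]x≈yx-zx f (a * c) (b * d)) (distribʳ e (a * d) (b * c)) ⟩
        (a * c * f - b * d * f) + (a * d * e + b * c * e)
          ≈⟨ interchange (a * c * f) (- (b * d * f)) (a * d * e) (b * c * e) ⟩
        (a * c * f + a * d * e) + (- (b * d * f) + b * c * e)
          ≈⟨ +-congˡ (+-comm _ _) ⟩
        (a * c * f + a * d * e) + (b * c * e - b * d * f)
          ≈⟨ +-cong (+-cong (*-assoc a c f) (*-assoc a d e))
                    (+-cong (*-assoc b c e) (-‿cong (*-assoc b d f))) ⟩
        (a * (c * f) + a * (d * e)) + (b * (c * e) - b * (d * f))
          ≈⟨ +-cong (distribˡ a (c * f) (d * e)) (x[y-z]≈xy-xz b (c * e) (d * f)) ⟨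
        a * (c * f + d * e) + b * (c * e - d * f) ∎)

  _[i] : CommutativeRing c ℓ
  _[i] = record
    { Carrier           = K².Carrier
    ; _≈_               = K²._≈_
    ; _+_               = K²._∙_
    ; _*_               = mul
    ; -_                = K²._⁻¹
    ; 0#                = K².ε
    ; 1#                = one
    ; isCommutativeRing = record
      { isRing = record
        { +-isAbelianGroup = K².isAbelianGroup
        ; *-cong           = mul-cong
        ; *-assoc          = mul-assoc
        ; *-identity       = ²Consequences.comm∧idˡ⇒id mul-comm mul-identityˡ
        ; distrib          =
            ²Consequences.comm∧distrˡ⇒distr K².∙-cong mul-comm mul-distribˡ
        }
      ; *-comm = mul-comm
      }
    }
    where module ²Consequences = Consequences K².setoid

complexNumbers : ∀ {c ℓ₁ ℓ₂} → CompleteOrderedField c ℓ₁ ℓ₂ → CommutativeRing c ℓ₁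
complexNumbers ℝ = CompleteOrderedField.commutativeRing ℝ [i]

-- Values of unit sum heights. The first infinite ordinal ω and ∞ record the
-- two ways in which a maximum of heights of elements can fail to be finite.

data Height : Set where
  fin : ℕ → Height
  ω ∞ : Height

infix 4 _≤ʰ_
data _≤ʰ_ : Rel Height 0ℓ where
  fin≤fin : ∀ {m n} → m ≤ n → fin m ≤ʰ fin n
  fin≤ω   : ∀ {m} → fin m ≤ʰ ω
  ω≤ω     : ω ≤ʰ ω
  ≤∞      : ∀ {h} → h ≤ʰ ∞

-- Fields and rings are given as subsets of an ambient commutative ring.

module SubsetsOf {c ℓ} (K : CommutativeRing c ℓ) where
  open CommutativeRing K public hiding (zero)
  open RawMonoidDefinitions +-rawMonoid public using (sum) renaming (_×_ to _·_)

  infixr 8 _·ℤ_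
  _·ℤ_ : ℤ → Carrier → Carrier
  (+ n)    ·ℤ x = n · x
  -[1+ n ] ·ℤ x = - (suc n · x)

  record IsSubring {r} (R : Pred Carrier r) : Set (c ⊔ ℓ ⊔ r) where
    field
      respects : R Respects _≈_
      0∈       : 0# ∈ R
      1∈       : 1# ∈ R
      +-closed : ∀ {x y} → x ∈ R → y ∈ R → x + y ∈ R
      -‿closed : ∀ {x} → x ∈ R → - x ∈ R
      *-closed : ∀ {x y} → x ∈ R → y ∈ R → x * y ∈ R

  record IsSubfield {f} (F : Pred Carrier f) : Set (c ⊔ ℓ ⊔ f) where
    field
      isSubring : IsSubring F
      1≉0       : ¬ 1# ≈ 0#
      inverse   : ∀ {x} → x ∈ F → ¬ x ≈ 0# → ∃[ y ] y ∈ F × x * y ≈ 1#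

  _∖0 : ∀ {f} → Pred Carrier f → Pred Carrier (ℓ ⊔ f)
  (F ∖0) x = x ∈ F × ¬ x ≈ 0#

  record IsMultiplicativeGroup {g} (Γ : Pred Carrier g) : Set (c ⊔ ℓ ⊔ g) where
    field
      respects : Γ Respects _≈_
      1∈       : 1# ∈ Γ
      *-closed : ∀ {x y} → x ∈ Γ → y ∈ Γ → x * y ∈ Γ
      inverse  : ∀ {x} → x ∈ Γ → ∃[ y ] y ∈ Γ × x * y ≈ 1#

  data ⟨_⟩ {k} (g : Vector Carrier k) : Pred Carrier (c ⊔ ℓ) where
    generator : ∀ i → g i ∈ ⟨ g ⟩
    respects  : ⟨ g ⟩ Respects _≈_
    1∈        : 1# ∈ ⟨ g ⟩
    *-closed  : ∀ {x y} → x ∈ ⟨ g ⟩ → y ∈ ⟨ g ⟩ → x * y ∈ ⟨ g ⟩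
    inverse   : ∀ {x y} → x ∈ ⟨ g ⟩ → x * y ≈ 1# → y ∈ ⟨ g ⟩

  FinitelyGenerated : ∀ {g} → Pred Carrier g → Set (c ⊔ ℓ ⊔ g)
  FinitelyGenerated Γ = ∃[ k ] Σ[ g ∈ Vector Carrier k ] Γ ≐ ⟨ g ⟩

  ℤ-span : ∀ {k} → Vector Carrier k → Pred Carrier ℓ
  ℤ-span {k} e x = Σ[ m ∈ Vector ℤ k ] x ≈ sum (λ i → m i ·ℤ e i)

  module UnitSums {g r} (Γ : Pred Carrier g) (R : Pred Carrier r) where

    record IsUnitSum (α : Carrier) {l} (a : Vector ℕ l) (ν : Vector Carrier l)
                     : Set (c ⊔ ℓ ⊔ g ⊔ r) where
      field
        positive : ∀ i → 0 < a i
        units    : ∀ i → ν i ∈ Γ ∩ R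
        distinct : Injective _≡_ _≈_ ν
        sums-to  : α ≈ sum (λ i → a i · ν i)

    -- The number of summands is suc l, so that there is a leading
    -- coefficient.
    record Representation (α : Carrier) : Set (c ⊔ ℓ ⊔ g ⊔ r) where
      field
        {l}        : ℕ
        a          : Vector ℕ (suc l)
        ν          : Vector Carrier (suc l)
        decreasing : ∀ {i j} → i ≤ᶠ j → a j ≤ a i
        isUnitSum  : IsUnitSum α a ν

    leading : ∀ {α} → Representation α → ℕ
    leading ρ = Representation.a ρ zero

    -- ElementHeight α h states that the unit sum height of α is h.
    data ElementHeight (α : Carrier) : Height → Set (c ⊔ ℓ ⊔ g ⊔ r) where
      ofZero   : α ≈ 0# → ElementHeight α (fin 0)
      smallest : ∀ {h} → ¬ α ≈ 0# →
                 (Σ[ ρ ∈ Representation α ] leading ρ ≡ h) → ((ρ : Representation α) → h ≤ leading ρ) →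
                 ElementHeight α (fin h)
      none     : ¬ α ≈ 0# → ¬ Representation α → ElementHeight α ∞

    IsMaximum : ℕ → Set (c ⊔ ℓ ⊔ g ⊔ r)
    IsMaximum m =
      (∃[ α ] α ∈ R × ElementHeight α (fin m)) ×
      (∀ α → α ∈ R → ∃[ h ] ElementHeight α h × h ≤ʰ fin m)

    -- RingHeight h states that the unit sum height of R is h.
    data RingHeight : Height → Set (c ⊔ ℓ ⊔ g ⊔ r) where
      maximum   : ∀ {m} → IsMaximum m → RingHeight (fin m)
      unbounded : (∀ α → α ∈ R → ∃[ h ] ElementHeight α (fin h)) →
                  (∀ m → ¬ IsMaximum m) → RingHeight ω
      infinite  : (∃[ α ] α ∈ R × ElementHeight α ∞) → RingHeight ∞

{-# OPTIONS --safe #-}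
-- Chips lie on the elements of Γ, and firing x replaces n chips at x by chips
-- at the u_i x. Firing preserves the total ∑ ν, does not increase the number of
-- chips and, since ∑ |u_i|² = n + ∑ |u_i - 1|² + (n - I), strictly increases the
-- potential ∑ |ν|². It remains to find, for each configuration c, a stable one
-- with the same total; the coefficients are then its multiplicities.
--
-- By induction on N there is a finite set T such that each c with at most N
-- chips has a stable configuration of the same total in c T. If c splits into
-- two nonempty parts c₁ and c₂ with c₁ T and c₂ T disjoint, then the stable
-- configurations of the parts can be put together. Otherwise c is h σ for one of
-- finitely many shapes σ. If c cannot be stabilised, it can be fired forever
-- through configurations of this kind, all with the total ∑ c ≠ 0; but since
-- |h|² |∑ σ|² = |∑ c|², the shape then determines the potential, which would take
-- only finitely many values. As Γ acts by translation, choosing a stable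
-- configuration for each of the finitely many σ suffices to enlarge T for N + 1.
module Submission where

open import Defs
open import Algebra.Bundles using (AbelianGroup; CommutativeRing)
import Algebra.Properties.AbelianGroup as AbelianGroupProperties
import Algebra.Properties.CommutativeSemigroup as CommutativeSemigroupProperties
import Algebra.Properties.Ring as RingProperties
import Algebra.Properties.Semiring.Mult as SemiringMult
import Algebra.Solver.Ring.NaturalCoefficients.Default as Solver
open import Axiom.ExcludedMiddle using (ExcludedMiddle)
open import Data.Fin.Base as Fin using (Fin)
open import Data.Integer.Base as ℤ using (ℤ; -[1+_])
open import Data.List.Base
  using (List; []; _∷_; _++_; [_]; map; foldr; filter; length; replicate;
         cartesianProductWith; lookup; tabulate; deduplicate)
open import Data.List.Membership.Propositional using (find) renaming (_∈_ to _∈ˡ_)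
open import Data.List.Membership.Propositional.Properties
  using (∈-++⁺ˡ; ∈-++⁺ʳ; ∈-++⁻; ∈-map⁺; ∈-map⁻; ∈-∃++; ∈-lookup;
         ∈-cartesianProductWith⁺; ∈-cartesianProductWith⁻)
open import Data.List.Properties
  using (length-++; length-map; length-replicate; length-tabulate; filter-++;
         filter-none; filter-some)
import Data.List.Relation.Binary.Permutation.Homogeneous as Homogeneous
import Data.List.Relation.Binary.Permutation.Propositional as ↭
import Data.List.Relation.Binary.Permutation.Propositional.Properties as PropositionalPermutation
import Data.List.Relation.Binary.Permutation.Setoid as Permutation
import Data.List.Relation.Binary.Permutation.Setoid.Properties as PermutationProperties
open import Data.List.Relation.Unary.All as All using (All; []; _∷_)
import Data.List.Relation.Unary.All.Properties as All
open import Data.List.Relation.Unary.AllPairs using (_∷_)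
open import Data.List.Relation.Unary.Any as Any using (Any; here; there; any?)
import Data.List.Relation.Unary.Any.Properties as Any
import Data.List.Relation.Unary.Sorted.TotalOrder.Properties as Sorted
import Data.List.Relation.Unary.Unique.DecSetoid.Properties as UniqueProperties
import Data.List.Relation.Unary.Unique.Setoid as Unique
import Data.List.Sort as Sort
open import Data.Nat.Base as ℕ using (ℕ; zero; suc; _≤_; _<_; _∸_; z≤n; s≤s)
import Data.Nat.Properties as ℕ
open import Data.Product.Base using (_×_; _,_; ∃-syntax; Σ-syntax; proj₁; proj₂)
open import Data.Sum.Base using (_⊎_; inj₁; inj₂)
open import Data.Vec.Functional using (Vector)
open import Function.Base using (_∘_; case_of_)
open import Level using (_⊔_) renaming (suc to lsuc)
open import Relation.Binary.Bundles
  using (Setoid; DecSetoid; DecTotalOrder; StrictPartialOrder)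
import Relation.Binary.Construct.Flip.EqAndOrd as Flip
import Relation.Binary.Construct.On as On
open import Relation.Binary.Definitions using (Decidable)
import Relation.Binary.Properties.Poset as PosetProperties
open import Relation.Binary.PropositionalEquality as ≡ using (_≡_)
open import Relation.Binary.Structures using (IsTotalOrder)
open import Relation.Nullary.Decidable using (yes; no)
open import Relation.Nullary.Negation using (¬_; contradiction)
open import Relation.Unary using (Pred; _∈_; _⊆_; _∩_; _≐_)

-- Weighted totals of configurations.

record Weight {g ℓg r ℓr} (G : AbelianGroup g ℓg) (R : CommutativeRing r ℓr)
              : Set (g ⊔ ℓg ⊔ r ⊔ ℓr) where
  private module G = AbelianGroup G
  open CommutativeRing R
  field
    w      : G.Carrier → Carrier
    w-cong : ∀ {x y} → x G.≈ y → w x ≈ w y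
    w-homo : ∀ x y → w (x G.∙ y) ≈ w x * w y

-- Instantiated twice: with the inclusion of Γ in ℂ the total is the sum of a configuration, with
-- the squared modulus it is its potential.
module WeightedTotals {g ℓg r ℓr} {G : AbelianGroup g ℓg} {R : CommutativeRing r ℓr}
                      (W : Weight G R) where
  private module G = AbelianGroup G
  open CommutativeRing R
  open Weight W
  open SemiringMult semiring using () renaming (_×_ to _·_)
  open Permutation G.setoid using (_↭_)

  total : List G.Carrier → Carrier
  total c = foldr _+_ 0# (map w c)

  total-↭ : ∀ {c d} → c ↭ d → total c ≈ total d
  total-↭ c↭d = PermutationProperties.foldr-commMonoid setoid +-isCommutativeMonoid
    (PermutationProperties.map⁺ G.setoid setoid w-cong c↭d)

  total-++ : ∀ c d → total (c ++ d) ≈ total c + total d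
  total-++ []      d = sym (+-identityˡ (total d))
  total-++ (x ∷ c) d = trans (+-congˡ (total-++ c d)) (sym (+-assoc _ _ _))

  total-replicate : ∀ m x → total (replicate m x) ≈ m · w x
  total-replicate zero    x = refl
  total-replicate (suc m) x = +-congˡ (total-replicate m x)

  total-translate : ∀ h c → total (map (h G.∙_) c) ≈ w h * total c
  total-translate h []      = sym (zeroʳ (w h))
  total-translate h (x ∷ c) =
    trans (+-cong (w-homo h x) (total-translate h c)) (sym (distribˡ _ _ _))

-- Words over a finite alphabet, and colourings by finitely many colours.

words : ∀ {a} {A : Set a} → ℕ → List A → List (List A)
words zero    D = [ [] ]
words (suc m) D = cartesianProductWith _∷_ D (words m D)

∈-words : ∀ {a} {A : Set a} {D : List A} {σ} → All (_∈ˡ D) σ → σ ∈ˡ words (length σ) D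
∈-words []       = here ≡.refl
∈-words (x∈ ∷ σ) = ∈-cartesianProductWith⁺ _∷_ x∈ (∈-words σ)

module _ (em : ∀ {a} → ExcludedMiddle a) where

  -- Induction on the list of colours. If the colour `k` occurs at some `y` above `x`, it cannot
  -- recur above `y`, because two elements of colour `k` are never strictly comparable; so the
  -- search restarts at `y` without `k`. Otherwise `k` is already absent above `x`. Once no colour
  -- is left, `step x` has none.
  no-finite-colouring :
    ∀ {x c p ℓ₁ ℓ₂ h} {X : Set x} {C : Set c} (O : StrictPartialOrder p ℓ₁ ℓ₂) →
    let open StrictPartialOrder O renaming (_<_ to _≺_) in
    (f : X → Carrier) (step : X → X) → (∀ x → f x ≺ f (step x)) →
    (Has : X → C → Set h) → (∀ {x y k} → Has x k → Has y k → ¬ f x ≺ f y) →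
    (ks : List C) (x : X) → ¬ (∀ y → f x ≺ f y → ∃[ k ] k ∈ˡ ks × Has y k)
  no-finite-colouring O f step f-incr Has same-≮ = go
    where
    open StrictPartialOrder O renaming (_<_ to _≺_) using (trans)
    go : ∀ ks x → ¬ (∀ y → f x ≺ f y → ∃[ k ] k ∈ˡ ks × Has y k)
    go []       x coloured with coloured (step x) (f-incr x)
    ... | _ , () , _
    go (k ∷ ks) x coloured with em {P = ∃[ y ] f x ≺ f y × Has y k}
    ... | yes (y , x≺y , yk) = go ks y λ z y≺z →
            case coloured z (trans x≺y y≺z) of λ where
              (_ , here ≡.refl , zk) → contradiction y≺z (same-≮ yk zk)
              (l , there l∈ , zl)    → l , l∈ , zl
    ... | no ¬∃ = go ks x λ z x≺z →
            case coloured z x≺z of λ where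
              (_ , here ≡.refl , zk) → contradiction (z , x≺z , zk) ¬∃
              (l , there l∈ , zl)    → l , l∈ , zl

-- Multiplicities of chips, and firing rules.

module Multiplicity (em : ∀ {a} → ExcludedMiddle a) {a ℓ} (S : Setoid a ℓ) where
  open Setoid S
  open Permutation S using (_↭_; prep; ↭-refl; ↭-sym; ↭-trans; ↭-prep)
  open PermutationProperties S using (↭-shift)

  _≟_ : Decidable _≈_
  _ ≟ _ = em

  mult : Carrier → List Carrier → ℕ
  mult x c = length (filter (x ≟_) c)

  mult-++ : ∀ x c d → mult x (c ++ d) ≡ mult x c ℕ.+ mult x d
  mult-++ x c d = ≡.trans (≡.cong length (filter-++ (x ≟_) c d)) (length-++ (filter (x ≟_) c))

  mult-zero : ∀ x c → mult x c ≡ 0 ⊎ (∃[ y ] y ∈ˡ c × x ≈ y)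
  mult-zero x c with any? (x ≟_) c
  ... | yes any = inj₂ (find any)
  ... | no ¬any = inj₁ (≡.cong length (filter-none (x ≟_) (All.¬Any⇒All¬ c ¬any)))

  mult-positive : ∀ {x c} → x ∈ˡ c → 0 < mult x c
  mult-positive {x} x∈c = filter-some (x ≟_) (Any.map reflexive x∈c)

  -- Turns a large multiplicity into the decomposition on which firing is defined.
  mult⇒replicate : ∀ {x} m c → m ≤ mult x c → ∃[ d ] c ↭ replicate m x ++ d
  mult⇒replicate {x} zero    c       _  = c , ↭-refl
  mult⇒replicate {x} (suc m) (y ∷ c) m≤ with x ≟ y
  ... | yes x≈y =
    let d , p = mult⇒replicate m c (ℕ.s≤s⁻¹ m≤) in
    d , prep (sym x≈y) p
  ... | no  x≉y =
    let d , p = mult⇒replicate (suc m) c m≤ in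
    y ∷ d , ↭-trans (↭-prep y p) (↭-sym (↭-shift (replicate (suc m) x) d))

-- Abstracts what the argument takes from the complex numbers: firing keeps the total, does not add
-- chips and raises the potential, whereas the potential cannot rise between two translates of one
-- shape that have the same nonzero total. `U` confines the factors by which chips may move.
record FiringRule {g ℓg r ℓr} {G : AbelianGroup g ℓg} {R : CommutativeRing r ℓr}
                  (W : Weight G R) u p ℓ₁ ℓ₂
                  : Set (g ⊔ ℓg ⊔ r ⊔ ℓr ⊔ lsuc (u ⊔ p ⊔ ℓ₁ ⊔ ℓ₂)) where
  private
    module G = AbelianGroup G
    module R = CommutativeRing R
  open WeightedTotals W
  open Permutation G.setoid using (_↭_)
  field
    U        : Pred G.Carrier u
    U-ε      : U G.ε
    U-∙      : ∀ {x y} → U x → U y → U (x G.∙ y)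
    n        : ℕ
    1≤n      : 1 ≤ n
    us       : List G.Carrier
    us-U     : All U us
    |us|≤n   : length us ≤ n
    us-total : ∀ x → total (map (x G.∙_) us) R.≈ total (replicate n x)
    order    : StrictPartialOrder p ℓ₁ ℓ₂

  open StrictPartialOrder order public using () renaming (_<_ to _≺_)
  field
    potential : List G.Carrier → StrictPartialOrder.Carrier order
    fire-≺    : ∀ {c} x d → c ↭ replicate n x ++ d →
                potential c ≺ potential (map (x G.∙_) us ++ d)
    shape-⊀   : ∀ {c d h k σ} → c ↭ map (h G.∙_) σ → d ↭ map (k G.∙_) σ →
                total c R.≈ total d → ¬ total c R.≈ R.0# →
                ¬ potential c ≺ potential d

-- Stabilisation of configurations.

module ChipFiring
  (em : ∀ {a} → ExcludedMiddle a)
  {g ℓg r ℓr u p ℓ₁ ℓ₂} {G : AbelianGroup g ℓg} {R : CommutativeRing r ℓr}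
  {W : Weight G R} (rule : FiringRule W u p ℓ₁ ℓ₂)
  where

  private module R = CommutativeRing R
  open FiringRule rule
  open WeightedTotals W
  open AbelianGroup G
  open AbelianGroupProperties G
  open Permutation setoid
    using (_↭_; prep; ↭-refl; ↭-reflexive; ↭-sym; ↭-trans; ↭-prep)
  open PermutationProperties setoid
  open Multiplicity em setoid

  mult-translate : ∀ x h c → mult x (map (h ∙_) c) ≡ mult (h ⁻¹ ∙ x) c
  mult-translate x h []      = ≡.refl
  mult-translate x h (y ∷ c) with x ≟ (h ∙ y) | (h ⁻¹ ∙ x) ≟ y
  ... | yes _    | yes _  = ≡.cong suc (mult-translate x h c)
  ... | no  _    | no  _  = mult-translate x h c
  ... | yes x≈hy | no  ≉y = contradiction (trans (∙-congˡ x≈hy) (\\-leftDividesʳ h y)) ≉y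
  ... | no  x≉hy | yes ≈y = contradiction (trans (sym (\\-leftDividesˡ h x)) (∙-congˡ ≈y)) x≉hy

  Stable : Pred (List Carrier) _
  Stable c = ∀ x → mult x c < n

  -- Places `s` in the product set `c P`. With `P = U` this will keep solutions inside `R`; with
  -- membership in a finite list `T` it bounds how far a solution spreads, so that distant parts do
  -- not interact.
  Within : ∀ {q} → Pred Carrier q → List Carrier → List Carrier → Set _
  Within P s c = ∀ {y} → y ∈ˡ s → ∃[ x ] ∃[ t ] x ∈ˡ c × P t × y ≈ x ∙ t

  record Solvable {q} (P : Pred Carrier q) (c : List Carrier) : Set (g ⊔ ℓg ⊔ ℓr ⊔ q) where
    field
      s         : List Carrier
      stable    : Stable s
      total≈    : total s R.≈ total c
      shorter   : length s ≤ length c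
      within    : Within P s c

  stable⇒solvable : ∀ {c} → Stable c → Solvable U c
  stable⇒solvable {c} st = record
    { s = c ; stable = st ; total≈ = R.refl ; shorter = ℕ.≤-refl
    ; within = λ {y} y∈ → y , ε , y∈ , U-ε , sym (identityʳ y) }

  -- The empty configuration is a solution; it is stable because `n` is positive.
  zero⇒solvable : ∀ {q} {P : Pred Carrier q} {c} → total c R.≈ R.0# → Solvable P c
  zero⇒solvable c≈0 = record
    { s = [] ; stable = λ _ → 1≤n ; total≈ = R.sym c≈0 ; shorter = z≤n ; within = λ () }

  solvable-mono : ∀ {q q′} {P : Pred Carrier q} {Q : Pred Carrier q′} {c} →
                  (∀ {t} → P t → Q t) → Solvable P c → Solvable Q c
  solvable-mono P⊆Q sol = record
    { s = s ; stable = stable ; total≈ = total≈ ; shorter = shorter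
    ; within = λ y∈ → let x , t , x∈ , t∈ , eq = within y∈ in x , t , x∈ , P⊆Q t∈ , eq }
    where open Solvable sol

  ∈-↭ : ∀ {c d x} → c ↭ d → x ∈ˡ c → ∃[ y ] y ∈ˡ d × x ≈ y
  ∈-↭ c↭d x∈c = find (∈-resp-↭ c↭d (Any.map reflexive x∈c))

  solvable-↭ : ∀ {q} {P : Pred Carrier q} {c d} → c ↭ d → Solvable P c → Solvable P d
  solvable-↭ c↭d sol = record
    { s = s ; stable = stable ; total≈ = R.trans total≈ (total-↭ c↭d)
    ; shorter = ℕ.≤-trans shorter (ℕ.≤-reflexive (xs↭ys⇒|xs|≡|ys| c↭d))
    ; within = λ y∈ →
        let x , t , x∈ , t∈ , y≈xt = within y∈
            z , z∈ , x≈z = ∈-↭ c↭d x∈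
        in z , t , z∈ , t∈ , trans y≈xt (∙-congʳ x≈z) }
    where open Solvable sol

  solvable-translate : ∀ {q} {P : Pred Carrier q} {c} h → Solvable P c → Solvable P (map (h ∙_) c)
  solvable-translate {c = c} h sol = record
    { s = map (h ∙_) s
    ; stable = λ x → ≡.subst (_< n) (≡.sym (mult-translate x h s)) (stable _)
    ; total≈ = R.trans (total-translate h s)
        (R.trans (R.*-congˡ total≈) (R.sym (total-translate h c)))
    ; shorter = ≡.subst₂ _≤_ (≡.sym (length-map (h ∙_) s)) (≡.sym (length-map (h ∙_) c)) shorter
    ; within = λ y∈ →
        let z , z∈ , y≡hz = ∈-map⁻ (h ∙_) y∈
            x , t , x∈ , t∈ , z≈xt = within z∈
        in h ∙ x , t , ∈-map⁺ (h ∙_) x∈ , t∈ ,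
           trans (reflexive y≡hz) (trans (∙-congˡ z≈xt) (sym (assoc h x t))) }
    where open Solvable sol

  Separated : List Carrier → List Carrier → List Carrier → Set _
  Separated T c d = ∀ {x y t t′} → x ∈ˡ c → y ∈ˡ d → t ∈ˡ T → t′ ∈ˡ T → ¬ x ∙ t ≈ y ∙ t′

  -- The solutions lie in the disjoint sets `c T` and `d T`, so no element carries chips of both,
  -- and each multiplicity in the concatenation comes from one of the two stable parts.
  solvable-++ : ∀ {T c d} → Separated T c d →
                Solvable (_∈ˡ T) c → Solvable (_∈ˡ T) d → Solvable (_∈ˡ T) (c ++ d)
  solvable-++ {T} {c} {d} sep sol₁ sol₂ = record
    { s = S₁.s ++ S₂.s
    ; stable = stable
    ; total≈ = R.trans (total-++ S₁.s S₂.s)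
        (R.trans (R.+-cong S₁.total≈ S₂.total≈) (R.sym (total-++ c d)))
    ; shorter = ≡.subst₂ _≤_ (≡.sym (length-++ S₁.s)) (≡.sym (length-++ c))
        (ℕ.+-mono-≤ S₁.shorter S₂.shorter)
    ; within = λ y∈ → case ∈-++⁻ S₁.s y∈ of λ where
        (inj₁ y∈₁) → let x , t , x∈ , rest = S₁.within y∈₁ in x , t , ∈-++⁺ˡ x∈ , rest
        (inj₂ y∈₂) → let x , t , x∈ , rest = S₂.within y∈₂ in x , t , ∈-++⁺ʳ c x∈ , rest }
    where
    module S₁ = Solvable sol₁
    module S₂ = Solvable sol₂
    stable : Stable (S₁.s ++ S₂.s)
    stable x rewrite mult-++ x S₁.s S₂.s with mult-zero x S₁.s | mult-zero x S₂.s
    ... | inj₁ eq | _ rewrite eq = S₂.stable x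
    ... | inj₂ _  | inj₁ eq rewrite eq | ℕ.+-identityʳ (mult x S₁.s) = S₁.stable x
    ... | inj₂ (y , y∈ , x≈y) | inj₂ (z , z∈ , x≈z) =
      let _ , _ , a∈ , t∈ , y≈at = S₁.within y∈
          _ , _ , b∈ , t′∈ , z≈bt′ = S₂.within z∈
      in contradiction (trans (sym y≈at) (trans (sym x≈y) (trans x≈z z≈bt′)))
                       (sep a∈ b∈ t∈ t′∈)

  -- Clusters and shapes.

  Ball : Carrier → List Carrier → Pred Carrier _
  Ball h D y = ∃[ d ] d ∈ˡ D × y ≈ h ∙ d

  Ball-resp : ∀ {h D x y} → x ≈ y → Ball h D x → Ball h D y
  Ball-resp x≈y (d , d∈ , x≈hd) = d , d∈ , trans (sym x≈y) x≈hd

  record Split (T c : List Carrier) : Set (g ⊔ ℓg) where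
    field
      {x y}     : Carrier
      {c₁ c₂}   : List Carrier
      c↭        : c ↭ (x ∷ c₁) ++ (y ∷ c₂)
      separated : Separated T (x ∷ c₁) (y ∷ c₂)

  split-↭ : ∀ {T c d} → c ↭ d → Split T d → Split T c
  split-↭ c↭d sp = record { c↭ = ↭-trans c↭d c↭ ; separated = separated }
    where open Split sp

  -- Absorbing the chips close to a cluster into it, until there are none left.
  split-or-ball : ∀ T m D → ∃[ E ] (∀ h x c d → length d ≤ m → All (Ball h D) (x ∷ c) →
                  Split T (x ∷ c ++ d) ⊎ All (Ball h E) (x ∷ c ++ d))
  split-or-ball T zero    D = D , λ where
    h x c [] _ ball → inj₂ (All.++⁺ ball [])
  split-or-ball T (suc m) D =
    -- If `a t ≈ b t′` with `a` in `h D`, then `b` lies in `h D T T⁻¹`.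
    let D′ = D ++ cartesianProductWith _∙_ D (cartesianProductWith (λ t t′ → t ∙ t′ ⁻¹) T T)
        E , grow = split-or-ball T m D′
    -- `D` is kept because the chips may run out before the bound `suc m` is reached.
    in E ++ D , λ where
      h x c []      _  ball →
        inj₂ (All.map (λ (d , d∈ , eq) → d , ∈-++⁺ʳ E d∈ , eq) (All.++⁺ ball []))
      h x c (y ∷ d) le ball →
        case em {P = ∃[ a ] ∃[ b ] ∃[ t ] ∃[ t′ ]
                     a ∈ˡ x ∷ c × b ∈ˡ y ∷ d × t ∈ˡ T × t′ ∈ˡ T × a ∙ t ≈ b ∙ t′} of λ where
          (no ¬close) → inj₁ (record
            { c↭ = ↭-refl
            ; separated = λ a∈ b∈ t∈ t′∈ eq → ¬close (_ , _ , _ , _ , a∈ , b∈ , t∈ , t′∈ , eq) })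
          (yes (a , b , t , t′ , a∈ , b∈ , t∈ , t′∈ , eq)) →
            let d₁ , d₂ , yd≡ = ∈-∃++ b∈
                z , z∈ , a≈hz = All.lookup ball a∈
                b≈ : b ≈ h ∙ (z ∙ (t ∙ t′ ⁻¹))
                b≈ = trans (x≈z//y b t′ (a ∙ t) (sym eq))
                       (trans (∙-congʳ (∙-congʳ a≈hz)) (trans (assoc _ _ _) (assoc _ _ _)))
                ball′ : All (Ball h D′) (b ∷ x ∷ c)
                ball′ = (_ , ∈-++⁺ʳ D (∈-cartesianProductWith⁺ _∙_ z∈
                              (∈-cartesianProductWith⁺ (λ t t′ → t ∙ t′ ⁻¹) t∈ t′∈)) , b≈)
                        ∷ All.map (λ (d , d∈ , eq) → d , ∈-++⁺ˡ d∈ , eq) ball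
                perm : x ∷ c ++ y ∷ d ↭ b ∷ (x ∷ c) ++ (d₁ ++ d₂)
                perm = ↭-trans (++⁺ˡ (x ∷ c) (↭-trans (↭-reflexive yd≡) (↭-shift d₁ d₂)))
                         (↭-shift (x ∷ c) (d₁ ++ d₂))
                len : length (d₁ ++ d₂) ≤ m
                len = ℕ.s≤s⁻¹ (ℕ.≤-trans (ℕ.≤-reflexive
                        (xs↭ys⇒|xs|≡|ys| (↭-sym (↭-trans (↭-reflexive yd≡) (↭-shift d₁ d₂))))) le)
            in case grow h b (x ∷ c) (d₁ ++ d₂) len ball′ of λ where
                 (inj₁ sp) → inj₁ (split-↭ perm sp)
                 (inj₂ ball″) → inj₂ (All.map (λ (d , d∈ , eq) → d , ∈-++⁺ˡ d∈ , eq)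
                   (All-resp-↭ Ball-resp (↭-sym perm) ball″))

  ball⇒shape : ∀ {h D c} → All (Ball h D) c →
               ∃[ σ ] All (_∈ˡ D) σ × length σ ≡ length c × c ↭ map (h ∙_) σ
  ball⇒shape [] = [] , [] , ≡.refl , ↭-refl
  ball⇒shape ((d , d∈ , eq) ∷ ball) =
    let σ , σ⊆D , len , perm = ball⇒shape ball in
    d ∷ σ , d∈ ∷ σ⊆D , ≡.cong suc len , prep eq perm

  -- One list `T` serves all configurations of at most `N` chips. This uniformity is what leaves
  -- only finitely many shapes at the next stage of the induction.
  Uniform : ℕ → List Carrier → Set _
  Uniform N T = ∀ c → length c ≤ N → Solvable (_∈ˡ T) c

  HasShape : List Carrier → List Carrier → Set _
  HasShape c σ = ∃[ h ] c ↭ map (h ∙_) σ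

  -- Both parts are nonempty, so each has at most `N` chips.
  split⇒solvable : ∀ {N T c} → Uniform N T → length c ≤ suc N → Split T c → Solvable (_∈ˡ T) c
  split⇒solvable {N} {T} {c} uni le sp = solvable-↭ (↭-sym c↭)
    (solvable-++ separated (uni (x ∷ c₁) le₁) (uni (y ∷ c₂) le₂))
    where
    open Split sp
    le′ : suc (length c₁) ℕ.+ suc (length c₂) ≤ suc N
    le′ = ≡.subst (_≤ suc N) (≡.trans (xs↭ys⇒|xs|≡|ys| c↭) (length-++ (x ∷ c₁))) le
    le₁ : suc (length c₁) ≤ N
    le₁ = ℕ.s≤s⁻¹ (ℕ.≤-trans (ℕ.≤-trans (ℕ.m≤m+n _ (length c₂))
            (ℕ.≤-reflexive (≡.sym (ℕ.+-suc _ (length c₂))))) le′)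
    le₂ : suc (length c₂) ≤ N
    le₂ = ℕ.≤-trans (ℕ.m≤n+m _ (length c₁)) (ℕ.s≤s⁻¹ le′)

  -- With fewer than `N + 1` chips the hypothesis applies. Otherwise a cluster grown from one chip
  -- either stops early, which splits `c`, or swallows `c`, which then lies in a translate of a list
  -- `E` depending on `N` and `T` only; the shapes are the words of length `N + 1` over `E`. The
  -- bound on their lengths makes the shapes themselves amenable to `uniform⇒solvable`.
  finitely-many-shapes : ∀ {N T} → Uniform N T →
    ∃[ Σs ] All (λ σ → length σ ≤ suc N) Σs ×
      (∀ c → length c ≤ suc N → Solvable (_∈ˡ T) c ⊎ (∃[ σ ] σ ∈ˡ Σs × HasShape c σ))
  finitely-many-shapes {N} {T} uni =
    words (suc N) E , All.tabulate (ℕ.≤-reflexive ∘ length-words) , classify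
    where
    E = proj₁ (split-or-ball T N [ ε ])
    length-words : ∀ {m σ} → σ ∈ˡ words m E → length σ ≡ m
    length-words {zero}  (here ≡.refl) = ≡.refl
    length-words {suc m} σ∈ with ∈-cartesianProductWith⁻ _∷_ E (words m E) σ∈
    ... | _ , _ , _ , τ∈ , ≡.refl = ≡.cong suc (length-words τ∈)
    classify : ∀ c → length c ≤ suc N →
      Solvable (_∈ˡ T) c ⊎ (∃[ σ ] σ ∈ˡ words (suc N) E × HasShape c σ)
    classify c le with ℕ.m≤n⇒m<n∨m≡n le
    ... | inj₁ lt = inj₁ (uni c (ℕ.s≤s⁻¹ lt))
    classify (x ∷ c) le | inj₂ eq =
      -- The initial cluster is the chip `x` alone, viewed as `x ε` in the translate of `[ ε ]` by
      -- `x`.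
      case proj₂ (split-or-ball T N [ ε ]) x x [] c (ℕ.s≤s⁻¹ le)
             ((ε , here ≡.refl , sym (identityʳ x)) ∷ []) of λ where
        (inj₁ sp)   → inj₁ (split⇒solvable uni le sp)
        (inj₂ ball) →
          let σ , σ⊆E , len , perm = ball⇒shape ball in
          inj₂ (σ , ≡.subst (λ m → σ ∈ˡ words m E) (≡.trans len eq) (∈-words σ⊆E) , x , perm)

  -- Firing and its termination.

  fire-total : ∀ {c} x d → c ↭ replicate n x ++ d → total (map (x ∙_) us ++ d) R.≈ total c
  fire-total x d c↭ = R.trans (total-++ (map (x ∙_) us) d) (R.trans (R.+-congʳ (us-total x))
    (R.trans (R.sym (total-++ (replicate n x) d)) (R.sym (total-↭ c↭))))

  fire-length : ∀ {c} x d → c ↭ replicate n x ++ d → length (map (x ∙_) us ++ d) ≤ length c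
  fire-length x d c↭ = ≡.subst₂ _≤_
    (≡.sym (≡.trans (length-++ (map (x ∙_) us)) (≡.cong (ℕ._+ length d) (length-map (x ∙_) us))))
    (≡.sym (≡.trans (xs↭ys⇒|xs|≡|ys| c↭) (≡.trans (length-++ (replicate n x))
      (≡.cong (ℕ._+ length d) (length-replicate n)))))
    (ℕ.+-monoˡ-≤ (length d) |us|≤n)

  -- The new chips lie in `x U` and `U` is closed under products, so whatever lies within `U` of the
  -- fired configuration lies within `U` of `c`.
  fire-solvable : ∀ {c} x d → c ↭ replicate n x ++ d →
                  Solvable U (map (x ∙_) us ++ d) → Solvable U c
  fire-solvable {c} x d c↭ sol = record
    { s = s ; stable = stable
    ; total≈ = R.trans total≈ (fire-total x d c↭)
    ; shorter = ℕ.≤-trans shorter (fire-length x d c↭)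
    ; within = λ y∈ →
        let a , t , a∈ , t∈ , y≈at = within y∈ in
        case ∈-++⁻ (map (x ∙_) us) a∈ of λ where
          (inj₁ a∈xus) →
            let v , v∈ , a≡xv = ∈-map⁻ (x ∙_) a∈xus
                -- Since `n` is positive, a chip equal to `x` really occurs in `c`.
                z , z∈ , x≈z = ∈-↭ (↭-sym c↭) (∈-++⁺ˡ (x∈replicate 1≤n))
            in z , v ∙ t , z∈ , U-∙ (All.lookup us-U v∈) t∈ ,
               trans y≈at (trans (∙-congʳ (trans (reflexive a≡xv) (∙-congʳ x≈z))) (assoc z v t))
          (inj₂ a∈d) →
            let z , z∈ , a≈z = ∈-↭ (↭-sym c↭) (∈-++⁺ʳ (replicate n x) a∈d)
            in z , t , z∈ , t∈ , trans y≈at (∙-congʳ a≈z) }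
    where
    open Solvable sol
    x∈replicate : ∀ {m} → 1 ≤ m → x ∈ˡ replicate m x
    x∈replicate (s≤s _) = here ≡.refl

  unsolvable⇒fire : ∀ {c} → ¬ Solvable U c → ∃[ x ] ∃[ d ] c ↭ replicate n x ++ d
  unsolvable⇒fire {c} ¬sol with em {P = ∃[ x ] n ≤ mult x c}
  ... | yes (x , n≤) = x , mult⇒replicate n c n≤
  ... | no  ¬∃       = contradiction (stable⇒solvable λ x → ℕ.≰⇒> λ n≤ → ¬∃ (x , n≤)) ¬sol

  -- The total of an unsolvable configuration is nonzero, so that its potential
  -- is a function of its shape; but firing strictly increases the potential,
  -- keeps the total and never leads to a solvable configuration.
  uniform⇒solvable : ∀ {N T} → All U T → Uniform N T → ∀ c → length c ≤ suc N → Solvable U c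
  uniform⇒solvable {N} {T} T-U uni c₀ |c₀|≤ with em {P = Solvable U c₀}
  ... | yes sol = sol
  ... | no ¬sol = contradiction (λ y _ → coloured y)
        (no-finite-colouring em order (potential ∘ proj₁) step step-≺
          (HasShape ∘ proj₁) (λ {b} {b′} → same-⊀ {b} {b′}) shapes (c₀ , ¬sol , |c₀|≤ , R.refl))
    where
    -- The bound on the length leaves finitely many shapes, and the fixed total makes the potentials
    -- of equal shapes comparable; firing preserves all the conditions.
    Bad : Set _
    Bad = ∃[ c ] ¬ Solvable U c × length c ≤ suc N × total c R.≈ total c₀

    shapes = proj₁ (finitely-many-shapes uni)

    coloured : ∀ ((c , _) : Bad) → ∃[ σ ] σ ∈ˡ shapes × HasShape c σ
    coloured (c , ¬sol , le , _) with proj₂ (proj₂ (finitely-many-shapes uni)) c le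
    ... | inj₁ sol   = contradiction (solvable-mono (All.lookup T-U) sol) ¬sol
    ... | inj₂ shape = shape

    step : Bad → Bad
    step (c , ¬sol , le , eq) =
      let x , d , c↭ = unsolvable⇒fire ¬sol in
      map (x ∙_) us ++ d , ¬sol ∘ fire-solvable x d c↭ ,
      ℕ.≤-trans (fire-length x d c↭) le , R.trans (fire-total x d c↭) eq

    step-≺ : ∀ b → potential (proj₁ b) ≺ potential (proj₁ (step b))
    step-≺ (c , ¬sol , _) = let x , d , c↭ = unsolvable⇒fire ¬sol in fire-≺ x d c↭

    same-⊀ : ∀ {b b′ : Bad} {σ} → HasShape (proj₁ b) σ → HasShape (proj₁ b′) σ →
             ¬ potential (proj₁ b) ≺ potential (proj₁ b′)
    same-⊀ {_ , ¬sol , _ , eq} {_ , _ , _ , eq′} (_ , p) (_ , q) =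
      shape-⊀ p q (R.trans eq (R.sym eq′)) (¬sol ∘ zero⇒solvable)

  -- Supports that depend on the number of chips only.

  -- Each of the finitely many chips of the solution uses one factor from `U`; these factors form
  -- `T`.
  finite-support : ∀ {c} → Solvable U c → ∃[ T ] All U T × Solvable (_∈ˡ T) c
  finite-support {c} sol =
    let T , T-U , w = support s within in
    T , T-U , record { s = s ; stable = stable ; total≈ = total≈ ; shorter = shorter ; within = w }
    where
    open Solvable sol
    support : ∀ s → Within U s c → ∃[ T ] All U T × Within (_∈ˡ T) s c
    support []      _ = [] , [] , λ ()
    support (y ∷ s) w =
      let x , t , x∈ , t-U , y≈xt = w (here ≡.refl)
          T , T-U , w′ = support s (w ∘ there)
      in t ∷ T , t-U ∷ T-U , λ where
        (here ≡.refl) → x , t , x∈ , here ≡.refl , y≈xt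
        (there z∈)    → let x , t , x∈ , t∈ , eq = w′ z∈ in x , t , x∈ , there t∈ , eq

  common-support : ∀ Σs → All (Solvable U) Σs →
                   ∃[ T ] All U T × (∀ {σ} → σ ∈ˡ Σs → Solvable (_∈ˡ T) σ)
  common-support []       []           = [] , [] , λ ()
  common-support (σ ∷ Σs) (sol ∷ sols) =
    let T  , T-U  , sol-σ  = finite-support sol
        T′ , T′-U , sol-Σs = common-support Σs sols
    in T ++ T′ , All.++⁺ T-U T′-U , λ where
      (here ≡.refl) → solvable-mono ∈-++⁺ˡ sol-σ
      (there σ∈)    → solvable-mono (∈-++⁺ʳ T) (sol-Σs σ∈)

  -- The old `T` serves the configurations that are short or split. Any other one is a translate of
  -- one of the finitely many shapes, and translating the solution chosen for that shape uses the
  -- same factors, which are collected in `T′`.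
  uniform : ∀ N → ∃[ T ] All U T × Uniform N T
  uniform zero    = [] , [] , λ where [] _ → zero⇒solvable R.refl
  uniform (suc N) =
    let T , T-U , uni = uniform N
        Σs , Σs-short , classify = finitely-many-shapes uni
        T′ , T′-U , sol = common-support Σs (All.map (uniform⇒solvable T-U uni _) Σs-short)
    in T ++ T′ , All.++⁺ T-U T′-U , λ c le → case classify c le of λ where
      (inj₁ sol-c) → solvable-mono ∈-++⁺ˡ sol-c
      (inj₂ (σ , σ∈ , h , c↭)) →
        solvable-↭ (↭-sym c↭) (solvable-translate h (solvable-mono (∈-++⁺ʳ T) (sol σ∈)))

  solvable : ∀ c → Solvable U c
  solvable c = let T , T-U , uni = uniform (length c) in
    solvable-mono (All.lookup T-U) (uni c ℕ.≤-refl)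

-- Squared moduli of complex numbers.

module OrderedFieldProperties
  (em : ∀ {a} → ExcludedMiddle a) {c ℓ₁ ℓ₂} (ℝ : CompleteOrderedField c ℓ₁ ℓ₂)
  where
  open CompleteOrderedField ℝ
  open IsTotalOrder isTotalOrder using (total; antisym; isPartialOrder)
    renaming (trans to ≼-trans; reflexive to ≼-reflexive; refl to ≼-refl)
  open RingProperties ring
  open CommutativeSemigroupProperties +-commutativeSemigroup using (interchange)
  open SemiringMult semiring using (×-cong; ×-homo-+) renaming (_×_ to _·_)
  open import Relation.Binary.Reasoning.Setoid setoid
  open Solver commutativeSemiring using (solve; _:=_; _:+_; _:*_; con)

  strictPartialOrder : StrictPartialOrder c ℓ₁ (ℓ₁ ⊔ ℓ₂)
  strictPartialOrder = PosetProperties.<-strictPartialOrder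
    (record { isPartialOrder = isPartialOrder })

  open StrictPartialOrder strictPartialOrder public using ()
    renaming (_<_ to _≺_; irrefl to ≺-irrefl)

  +-nonNegative : ∀ {x y} → 0# ≼ x → 0# ≼ y → 0# ≼ x + y
  +-nonNegative {x} {y} 0≼x 0≼y =
    ≼-trans 0≼x (≼-trans (≼-reflexive (sym (+-identityʳ x))) (+-monoʳ-≼ x 0≼y))

  *-nonZero : ∀ {x y} → ¬ x ≈ 0# → ¬ y ≈ 0# → ¬ x * y ≈ 0#
  *-nonZero {x} {y} x≉0 y≉0 xy≈0 = let x⁻¹ , xx⁻¹≈1 = inverse x x≉0 in y≉0 (begin
    y              ≈⟨ *-identityˡ y ⟨
    1# * y         ≈⟨ *-congʳ (trans (*-comm x⁻¹ x) xx⁻¹≈1) ⟨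
    x⁻¹ * x * y    ≈⟨ *-assoc x⁻¹ x y ⟩
    x⁻¹ * (x * y)  ≈⟨ *-congˡ xy≈0 ⟩
    x⁻¹ * 0#       ≈⟨ zeroʳ x⁻¹ ⟩
    0#             ∎)

  *-cancelʳ : ∀ {x y z} → ¬ z ≈ 0# → x * z ≈ y * z → x ≈ y
  *-cancelʳ {x} {y} {z} z≉0 xz≈yz = let z⁻¹ , zz⁻¹≈1 = inverse z z≉0 in begin
    x              ≈⟨ *-identityʳ x ⟨
    x * 1#         ≈⟨ *-congˡ zz⁻¹≈1 ⟨
    x * (z * z⁻¹)  ≈⟨ *-assoc x z z⁻¹ ⟨
    x * z * z⁻¹    ≈⟨ *-congʳ xz≈yz ⟩
    y * z * z⁻¹    ≈⟨ *-assoc y z z⁻¹ ⟩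
    y * (z * z⁻¹)  ≈⟨ *-congˡ zz⁻¹≈1 ⟩
    y * 1#         ≈⟨ *-identityʳ y ⟩
    y              ∎

  square-nonNegative : ∀ x → 0# ≼ x * x
  square-nonNegative x with total 0# x
  ... | inj₁ 0≼x = *-nonNegative 0≼x 0≼x
  ... | inj₂ x≼0 = ≼-trans (*-nonNegative 0≼-x 0≼-x) (≼-reflexive (-x*-y≈x*y x x))
    where
    -x*-y≈x*y : ∀ x y → - x * - y ≈ x * y
    -x*-y≈x*y x y = trans (sym (-‿distribˡ-* x (- y)))
      (trans (-‿cong (sym (-‿distribʳ-* x y))) (-‿involutive (x * y)))
    0≼-x : 0# ≼ - x
    0≼-x = ≼-trans (≼-reflexive (sym (-‿inverseˡ x)))
      (≼-trans (+-monoʳ-≼ (- x) x≼0) (≼-reflexive (+-identityʳ (- x))))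

  0≼1 : 0# ≼ 1#
  0≼1 = ≼-trans (square-nonNegative 1#) (≼-reflexive (*-identityˡ 1#))

  ·-nonNegative : ∀ m → 0# ≼ m · 1#
  ·-nonNegative zero    = ≼-refl
  ·-nonNegative (suc m) = +-nonNegative 0≼1 (·-nonNegative m)

  x+y≈0⇒x≈0 : ∀ {x y} → 0# ≼ x → 0# ≼ y → x + y ≈ 0# → x ≈ 0#
  x+y≈0⇒x≈0 {x} {y} 0≼x 0≼y x+y≈0 = antisym
    (≼-trans (≼-reflexive (sym (+-identityʳ x))) (≼-trans (+-monoʳ-≼ x 0≼y) (≼-reflexive x+y≈0)))
    0≼x

  increment-≺ : ∀ {x y δ} → 0# ≼ δ → ¬ δ ≈ 0# → y ≈ x + δ → x ≺ y
  increment-≺ {x} {y} {δ} 0≼δ δ≉0 y≈x+δ =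
    ≼-trans (≼-reflexive (sym (+-identityʳ x)))
      (≼-trans (+-monoʳ-≼ x 0≼δ) (≼-reflexive (sym y≈x+δ))) ,
    λ x≈y → δ≉0 (+-cancelˡ x δ 0# (trans (sym y≈x+δ) (trans (sym x≈y) (sym (+-identityʳ x)))))

  ℂ : CommutativeRing c ℓ₁
  ℂ = complexNumbers ℝ
  module ℂ = CommutativeRing ℂ
  module ℂ-Properties = RingProperties ℂ.ring
  open SemiringMult ℂ.semiring using () renaming (_×_ to _·ℂ_)

  norm : ℂ.Carrier → Carrier
  norm (a , b) = a * a + b * b

  norm-cong : ∀ {x y} → x ℂ.≈ y → norm x ≈ norm y
  norm-cong (p , q) = +-cong (*-cong p p) (*-cong q q)

  norm-nonNegative : ∀ x → 0# ≼ norm x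
  norm-nonNegative (a , b) = +-nonNegative (square-nonNegative a) (square-nonNegative b)

  -- The Brahmagupta-Fibonacci identity. To make it an identity of semirings, `p = ac` is written as
  -- `v + e` with `e = bd`, and `2pe` is added to both sides.
  norm-homo : ∀ x y → norm (x ℂ.* y) ≈ norm x * norm y
  norm-homo (a , b) (c , d) = +-cancelʳ (p * e + p * e) _ _ (begin
    v * v + w * w + (p * e + p * e)
      ≈⟨ +-congˡ (+-cong (*-congʳ p≈v+e) (*-congʳ p≈v+e)) ⟩
    v * v + w * w + ((v + e) * e + (v + e) * e)
      ≈⟨ solve 3 (λ v w e →
           v :* v :+ w :* w :+ ((v :+ e) :* e :+ (v :+ e) :* e) :=
           (v :+ e) :* (v :+ e) :+ e :* e :+ w :* w) refl v w e ⟩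
    (v + e) * (v + e) + e * e + w * w
      ≈⟨ +-congʳ (+-congʳ (*-cong p≈v+e p≈v+e)) ⟨
    p * p + e * e + w * w
      ≈⟨ solve 4 (λ a b c d →
           (a :* c) :* (a :* c) :+ (b :* d) :* (b :* d) :+
             (a :* d :+ b :* c) :* (a :* d :+ b :* c) :=
           (a :* a :+ b :* b) :* (c :* c :+ d :* d) :+
             ((a :* c) :* (b :* d) :+ (a :* c) :* (b :* d))) refl a b c d ⟩
    (a * a + b * b) * (c * c + d * d) + (p * e + p * e) ∎)
    where
    p = a * c
    e = b * d
    v = p - e
    w = a * d + b * c
    p≈v+e : p ≈ v + e
    p≈v+e = sym (//-rightDividesˡ e p)

  norm-zero : ∀ x → norm x ≈ 0# → x ℂ.≈ ℂ.0#
  norm-zero (a , b) n≈0 =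
    square-zero a (x+y≈0⇒x≈0 (square-nonNegative a) (square-nonNegative b) n≈0) ,
    square-zero b (x+y≈0⇒x≈0 (square-nonNegative b) (square-nonNegative a) (trans (+-comm _ _) n≈0))
    where
    square-zero : ∀ x → x * x ≈ 0# → x ≈ 0#
    square-zero x xx≈0 with em {P = x ≈ 0#}
    ... | yes x≈0 = x≈0
    ... | no  x≉0 = contradiction xx≈0 (*-nonZero x≉0 x≉0)

  re-· : ∀ m → proj₁ (m ·ℂ ℂ.1#) ≈ m · 1#
  re-· zero    = refl
  re-· (suc m) = +-congˡ (re-· m)

  norms deviations : List ℂ.Carrier → Carrier
  norms us = foldr _+_ 0# (map norm us)
  deviations us = foldr _+_ 0# (map (λ u → norm (u ℂ.- ℂ.1#)) us)

  deviations-nonNegative : ∀ us → 0# ≼ deviations us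
  deviations-nonNegative []       = ≼-refl
  deviations-nonNegative (u ∷ us) = +-nonNegative (norm-nonNegative _) (deviations-nonNegative us)

  deviations-zero : ∀ us → deviations us ≈ 0# → All (ℂ._≈ ℂ.1#) us
  deviations-zero []       _   = []
  deviations-zero (u ∷ us) d≈0 =
    ℂ-Properties.x∙y⁻¹≈ε⇒x≈y u ℂ.1# (norm-zero _ (x+y≈0⇒x≈0 0≼x 0≼y d≈0)) ∷
    deviations-zero us (x+y≈0⇒x≈0 0≼y 0≼x (trans (+-comm _ _) d≈0))
    where
    0≼x = norm-nonNegative (u ℂ.- ℂ.1#)
    0≼y = deviations-nonNegative us

  -- The expansion of `|u - 1|²`, arranged without subtraction.
  norm-shift : ∀ u → norm u + 1# ≈ norm (u ℂ.- ℂ.1#) + (proj₁ u + proj₁ u)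
  norm-shift (a , b) = begin
    a * a + b * b + 1#
      ≈⟨ +-congʳ (+-cong (*-cong a≈v+1 a≈v+1) (*-cong b≈ b≈)) ⟩
    (v + 1#) * (v + 1#) + w * w + 1#
      ≈⟨ solve 2 (λ v w → (v :+ con 1) :* (v :+ con 1) :+ w :* w :+ con 1 :=
           v :* v :+ w :* w :+ ((v :+ con 1) :+ (v :+ con 1))) refl v w ⟩
    v * v + w * w + ((v + 1#) + (v + 1#))
      ≈⟨ +-congˡ (+-cong a≈v+1 a≈v+1) ⟨
    v * v + w * w + (a + a) ∎
    where
    v = a - 1#
    w = b - 0#
    a≈v+1 : a ≈ v + 1#
    a≈v+1 = sym (//-rightDividesˡ 1# a)
    b≈ : b ≈ w
    b≈ = sym (trans (+-congˡ -0#≈0#) (+-identityʳ b))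

  norms-shift : ∀ us → let re = proj₁ (foldr ℂ._+_ ℂ.0# us) in
                norms us + length us · 1# ≈ deviations us + (re + re)
  norms-shift []       = +-congˡ (sym (+-identityˡ 0#))
  norms-shift (u ∷ us) = begin
    norm u + norms us + (1# + length us · 1#)
      ≈⟨ interchange _ _ _ _ ⟩
    (norm u + 1#) + (norms us + length us · 1#)
      ≈⟨ +-cong (norm-shift u) (norms-shift us) ⟩
    (norm (u ℂ.- ℂ.1#) + (a + a)) + (deviations us + (re + re))
      ≈⟨ solve 4 (λ x a d r → (x :+ (a :+ a)) :+ (d :+ (r :+ r)) :=
           (x :+ d) :+ ((a :+ r) :+ (a :+ r))) refl _ a _ re ⟩
    (norm (u ℂ.- ℂ.1#) + deviations us) + ((a + re) + (a + re)) ∎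
    where
    a = proj₁ u
    re = proj₁ (foldr ℂ._+_ ℂ.0# us)

  -- What `∑ |u|²` has beyond `n` when the `u` sum to `n`. The truncated subtraction is exact for at
  -- most `n` summands.
  excess : ℕ → List ℂ.Carrier → Carrier
  excess n us = deviations us + (n ∸ length us) · 1#

  -- As the real parts add up to `n`, summing `norm-shift` gives `∑ |u|² + l = ∑ |u - 1|² + 2n` with
  -- `l` the number of summands; then `2n` is split as `n + (n - l) + l`.
  norms-excess : ∀ n us → length us ≤ n → foldr ℂ._+_ ℂ.0# us ℂ.≈ n ·ℂ ℂ.1# →
                 norms us ≈ n · 1# + excess n us
  norms-excess n us l≤n us≈n = +-cancelʳ (length us · 1#) _ _ (begin
    norms us + l                  ≈⟨ norms-shift us ⟩
    D + (re + re)                 ≈⟨ +-congˡ (+-cong re≈n re≈n) ⟩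
    D + (n · 1# + n · 1#)         ≈⟨ +-congˡ (+-congˡ n≈) ⟩
    D + (n · 1# + (n-l + l))
      ≈⟨ solve 4 (λ d n m l → d :+ (n :+ (m :+ l)) := n :+ (d :+ m) :+ l) refl D (n · 1#) n-l l ⟩
    n · 1# + (D + n-l) + l        ∎)
    where
    l = length us · 1#
    n-l = (n ∸ length us) · 1#
    D = deviations us
    re = proj₁ (foldr ℂ._+_ ℂ.0# us)
    re≈n : re ≈ n · 1#
    re≈n = trans (proj₁ us≈n) (re-· n)
    n≈ : n · 1# ≈ n-l + l
    n≈ = trans (×-cong (≡.sym (ℕ.m∸n+n≡m l≤n)) refl) (×-homo-+ 1# (n ∸ length us) (length us))

  excess-nonNegative : ∀ n us → 0# ≼ excess n us
  excess-nonNegative n us =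
    +-nonNegative (deviations-nonNegative us) (·-nonNegative (n ∸ length us))

  -- Both parts of the excess are nonnegative, so every `|u - 1|²` vanishes. Hence a solution other
  -- than all ones has nonzero excess.
  excess-zero : ∀ n us → excess n us ≈ 0# → All (ℂ._≈ ℂ.1#) us
  excess-zero n us e≈0 = deviations-zero us
    (x+y≈0⇒x≈0 (deviations-nonNegative us) (·-nonNegative (n ∸ length us)) e≈0)

-- Collecting equal chips into coefficients.

module Grouping
  (em : ∀ {a} → ExcludedMiddle a)
  {g ℓg r ℓr} {G : AbelianGroup g ℓg} {R : CommutativeRing r ℓr} (W : Weight G R)
  where
  private module G = AbelianGroup G
  open CommutativeRing R
  open Weight W
  open WeightedTotals W
  open Multiplicity em G.setoid
  open CommutativeSemigroupProperties +-commutativeSemigroup using (x∙yz≈y∙xz)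
  open SemiringMult semiring using (×-congˡ) renaming (_×_ to _·_)
  open Unique G.setoid public using (Unique)
  open import Relation.Binary.Reasoning.Setoid setoid

  grouped : List G.Carrier → List G.Carrier → Carrier
  grouped s L = foldr _+_ 0# (map (λ x → mult x s · w x) L)

  grouped-[] : ∀ L → grouped [] L ≈ 0#
  grouped-[] []      = refl
  grouped-[] (x ∷ L) = trans (+-identityˡ _) (grouped-[] L)

  mult-accept : ∀ {x y} s → x G.≈ y → mult x (y ∷ s) ≡ suc (mult x s)
  mult-accept {x} {y} s x≈y with x ≟ y
  ... | yes _   = ≡.refl
  ... | no  x≉y = contradiction x≈y x≉y

  mult-reject : ∀ {x y} s → ¬ x G.≈ y → mult x (y ∷ s) ≡ mult x s
  mult-reject {x} {y} s x≉y with x ≟ y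
  ... | yes x≈y = contradiction x≈y x≉y
  ... | no  _   = ≡.refl

  grouped-∉ : ∀ {x} s {L} → All (λ y → ¬ x G.≈ y) L → grouped (x ∷ s) L ≈ grouped s L
  grouped-∉ s []         = refl
  grouped-∉ s (x≉y ∷ x∉) = +-cong (×-congˡ (mult-reject s (x≉y ∘ G.sym))) (grouped-∉ s x∉)

  -- Exactly one entry of `L` equals `x`, so exactly one coefficient rises, and it rises by one.
  grouped-∈ : ∀ {x} s {L} → Unique L → Any (x G.≈_) L → grouped (x ∷ s) L ≈ w x + grouped s L
  grouped-∈ {x} s {y ∷ L} (y∉ ∷ _) (here x≈y) = begin
    mult y (x ∷ s) · w y + grouped (x ∷ s) L
      ≈⟨ +-cong (×-congˡ (mult-accept s (G.sym x≈y))) (grouped-∉ s x∉) ⟩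
    (w y + mult y s · w y) + grouped s L
      ≈⟨ +-assoc _ _ _ ⟩
    w y + (mult y s · w y + grouped s L)
      ≈⟨ +-congʳ (w-cong x≈y) ⟨
    w x + (mult y s · w y + grouped s L) ∎
    where
    x∉ = All.map (λ y≉z x≈z → y≉z (G.trans (G.sym x≈y) x≈z)) y∉
  grouped-∈ {x} s {y ∷ L} (y∉ ∷ uniq) (there x∈) = begin
    mult y (x ∷ s) · w y + grouped (x ∷ s) L
      ≈⟨ +-cong (×-congˡ (mult-reject s y≉x)) (grouped-∈ s uniq x∈) ⟩
    mult y s · w y + (w x + grouped s L)
      ≈⟨ x∙yz≈y∙xz _ _ _ ⟩
    w x + (mult y s · w y + grouped s L) ∎
    where
    y≉x : ¬ y G.≈ x
    y≉x y≈x = All.lookupWith (λ y≉z x≈z → y≉z (G.trans y≈x x≈z)) y∉ x∈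

  grouped≈total : ∀ {L} → Unique L → ∀ s → All (λ x → Any (x G.≈_) L) s → grouped s L ≈ total s
  grouped≈total {L} uniq []      []       = grouped-[] L
  grouped≈total     uniq (x ∷ s) (x∈ ∷ s∈) =
    trans (grouped-∈ s uniq x∈) (+-congˡ (grouped≈total uniq s s∈))

  lookup-injective : ∀ {L} → Unique L → ∀ {i j} → lookup L i G.≈ lookup L j → i ≡ j
  lookup-injective (_  ∷ _)    {Fin.zero}  {Fin.zero}  _  = ≡.refl
  lookup-injective (x∉ ∷ _)    {Fin.zero}  {Fin.suc j} eq =
    contradiction eq (All.lookup x∉ (∈-lookup j))
  lookup-injective (x∉ ∷ _)    {Fin.suc i} {Fin.zero}  eq =
    contradiction (G.sym eq) (All.lookup x∉ (∈-lookup i))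
  lookup-injective (_  ∷ uniq) {Fin.suc i} {Fin.suc j} eq =
    ≡.cong Fin.suc (lookup-injective uniq eq)

  record Grouped (s : List G.Carrier) : Set (g ⊔ ℓg ⊔ ℓr) where
    field
      L          : List G.Carrier
      unique     : Unique L
      subset     : All (_∈ˡ s) L
      decreasing : ∀ {i j} → i Fin.≤ j → mult (lookup L j) s ≤ mult (lookup L i) s
      total≈     : grouped s L ≈ total s

  group : ∀ s → Grouped s
  group s = record
    { L = sort D
    ; unique = unique
    ; subset = PropositionalPermutation.All-resp-↭ (↭.↭-sym (sort-↭ D))
        (All.deduplicate⁺ _≟_ (All.tabulate λ x∈ → x∈))
    ; decreasing = Sorted.lookup-mono-≤ (DecTotalOrder.totalOrder byMult) (sort-↗ D)
    ; total≈ = grouped≈total unique s (All.tabulate λ {x} x∈ →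
        PropositionalPermutation.Any-resp-↭ (↭.↭-sym (sort-↭ D))
          (Any.deduplicate⁺ _≟_ (λ b≈a x≈a → G.trans x≈a (G.sym b≈a)) (Any.map G.reflexive x∈))) }
    where
    decSetoid : DecSetoid _ _
    decSetoid = record { isDecEquivalence = record { isEquivalence = G.isEquivalence ; _≟_ = _≟_ } }
    D = deduplicate _≟_ s
    byMult : DecTotalOrder _ _ _
    -- The order is flipped so that sorting lists the largest multiplicity first.
    byMult = On.decTotalOrder (Flip.decTotalOrder ℕ.≤-decTotalOrder) (λ x → mult x s)
    open Sort byMult using (sort; sort-↭; sort-↗)
    unique : Unique (sort D)
    unique = PermutationProperties.Unique-resp-↭ G.setoid
      (Permutation.↭-sym G.setoid (Homogeneous.map G.reflexive (↭.↭⇒↭ₛ (sort-↭ D))))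
      (UniqueProperties.deduplicate-! decSetoid s)

-- Extremal natural numbers.

module _ (em : ∀ {a} → ExcludedMiddle a) where

  least : ∀ {p} (P : Pred ℕ p) {m} → P m → ∃[ h ] P h × (∀ k → P k → h ≤ k)
  least P {m} Pm = below m (m , Pm , ℕ.≤-refl)
    where
    below : ∀ b → ∃[ k ] P k × k ≤ b → ∃[ h ] P h × (∀ k → P k → h ≤ k)
    below zero    (_ , P0 , z≤n) = 0 , P0 , λ _ _ → z≤n
    below (suc b) (k , Pk , k≤) with em {P = ∃[ k ] P k × k ≤ b}
    ... | yes smaller = below b smaller
    ... | no ¬smaller = k , Pk , λ j Pj →
      ℕ.≤-trans k≤ (ℕ.≰⇒> λ j≤b → ¬smaller (j , Pj , j≤b))

  greatest : ∀ {p} (P : Pred ℕ p) b → P 0 → (∀ k → P k → k ≤ b) →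
             ∃[ m ] P m × (∀ k → P k → k ≤ m)
  greatest P zero    P0 bound = 0 , P0 , bound
  greatest P (suc b) P0 bound with em {P = P (suc b)}
  ... | yes Pb = suc b , Pb , bound
  ... | no ¬Pb = greatest P b P0 λ k Pk → case ℕ.m≤n⇒m<n∨m≡n (bound k Pk) of λ where
    (inj₁ k<)     → ℕ.s≤s⁻¹ k<
    (inj₂ ≡.refl) → contradiction Pk ¬Pb

-- Unit sums from stable configurations.

module UnitSumRepresentations
  (em : ∀ {a} → ExcludedMiddle a) {c ℓ₁ ℓ₂} (ℝ : CompleteOrderedField c ℓ₁ ℓ₂)
  where
  open SubsetsOf (complexNumbers ℝ)

  module Solution
    {g r} (Γ : Pred Carrier g) (Γ-group : IsMultiplicativeGroup Γ)
    (Γ-nonZero : ∀ {x} → x ∈ Γ → ¬ x ≈ 0#) (-1∈Γ : - 1# ∈ Γ)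
    (R : Pred Carrier r) (R-subring : IsSubring R)
    (n I : ℕ) (2≤I : 2 ≤ I) (I≤n : I ≤ n)
    (u : Vector Carrier I) (u∈ : ∀ i → u i ∈ Γ ∩ R)
    (u-sum : sum u ≈ n · 1#) (u≉1 : ¬ (∀ i → u i ≈ 1#))
    where
    private
      module Γ = IsMultiplicativeGroup Γ-group
      module R = IsSubring R-subring
      module ℝ = CompleteOrderedField ℝ
    open OrderedFieldProperties em ℝ hiding (module ℂ; ℂ)
    open RingProperties ring using (-1*x≈-x)
    open SemiringMult semiring using (×-comm-*; ×-congʳ)
    open UnitSums Γ R
    private module ℝ× = SemiringMult ℝ.semiring
    open ℝ× using () renaming (_×_ to _·ℝ_)

    -- Equality compares values and ignores proofs of membership in Γ. The inverse is chosen from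
    -- such a proof, so `inverse-cong` has to show that the choice does not matter.
    G : AbelianGroup (c ⊔ g) ℓ₁
    G = record
      { Carrier = ∃[ x ] x ∈ Γ
      ; _≈_ = λ x y → proj₁ x ≈ proj₁ y
      ; _∙_ = λ (x , x∈) (y , y∈) → x * y , Γ.*-closed x∈ y∈
      ; ε = 1# , Γ.1∈
      ; _⁻¹ = λ (x , x∈) → let y , y∈ , _ = Γ.inverse x∈ in y , y∈
      ; isAbelianGroup = record
        { isGroup = record
          { isMonoid = record
            { isSemigroup = record
              { isMagma = record
                { isEquivalence = record { refl = refl ; sym = sym ; trans = trans }
                ; ∙-cong = *-cong }
              ; assoc = λ _ _ _ → *-assoc _ _ _ }
            ; identity = (λ _ → *-identityˡ _) , (λ _ → *-identityʳ _) }
          ; inverse = (λ (x , x∈) → trans (*-comm _ _) (proj₂ (proj₂ (Γ.inverse x∈)))) ,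
                      (λ (x , x∈) → proj₂ (proj₂ (Γ.inverse x∈)))
          ; ⁻¹-cong = λ {x} {y} → inverse-cong x y }
        ; comm = λ _ _ → *-comm _ _ } }
      where
      inverse-cong : ∀ ((x , x∈) (y , y∈) : ∃[ x ] x ∈ Γ) → x ≈ y →
                     proj₁ (Γ.inverse x∈) ≈ proj₁ (Γ.inverse y∈)
      inverse-cong (x , x∈) (y , y∈) x≈y =
        let x⁻¹ , _ , xx⁻¹≈1 = Γ.inverse x∈
            y⁻¹ , _ , yy⁻¹≈1 = Γ.inverse y∈
        in trans (sym (*-identityʳ x⁻¹)) (trans (*-congˡ (sym yy⁻¹≈1)) (trans (sym (*-assoc _ _ _))
             (trans (*-congʳ (trans (*-comm _ _) (trans (*-congʳ (sym x≈y)) xx⁻¹≈1)))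
               (*-identityˡ y⁻¹))))

    module G = AbelianGroup G
    open Permutation G.setoid using (_↭_)

    W : Weight G (complexNumbers ℝ)
    W = record { w = proj₁ ; w-cong = λ x≈y → x≈y ; w-homo = λ _ _ → refl }

    normWeight : Weight G ℝ.commutativeRing
    normWeight = record
      { w = norm ∘ proj₁ ; w-cong = norm-cong ; w-homo = λ _ _ → norm-homo _ _ }

    open WeightedTotals W public
    module Norm = WeightedTotals normWeight

    -- Elements of `G` are in Γ already, so membership in `R` cuts out `Γ ∩ R`.
    U : Pred G.Carrier r
    U (x , _) = R x

    us : List G.Carrier
    us = tabulate (λ i → u i , proj₁ (u∈ i))

    |us|≡I : length us ≡ I
    |us|≡I = length-tabulate _

    |us|≤n : length us ≤ n
    |us|≤n = ≡.subst (_≤ n) (≡.sym |us|≡I) I≤n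

    total-tabulate : ∀ {m} (v : Fin m → G.Carrier) → total (tabulate v) ≡ sum (proj₁ ∘ v)
    total-tabulate {zero}  v = ≡.refl
    total-tabulate {suc m} v = ≡.cong (proj₁ (v Fin.zero) +_) (total-tabulate (v ∘ Fin.suc))

    us≈n : total us ≈ n · 1#
    us≈n = trans (reflexive (total-tabulate λ i → u i , proj₁ (u∈ i))) u-sum

    us-total : ∀ x → total (map (x G.∙_) us) ≈ total (replicate n x)
    us-total x = trans (total-translate x us) (trans (*-congˡ us≈n)
      (trans (×-comm-* n _ _) (trans (×-congʳ n (*-identityʳ _)) (sym (total-replicate n x)))))

    values : List G.Carrier → List Carrier
    values = map proj₁

    norms-values : ∀ c → Norm.total c ≡ norms (values c)
    norms-values []      = ≡.refl
    norms-values (x ∷ c) = ≡.cong (norm (proj₁ x) ℝ.+_) (norms-values c)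

    -- The gain of the potential in firing 1.
    δ : ℝ.Carrier
    δ = excess n (values us)

    |values|≤n : length (values us) ≤ n
    |values|≤n = ≡.subst (_≤ n) (≡.sym (length-map proj₁ us)) |us|≤n

    us-norms : Norm.total us ℝ.≈ n ·ℝ ℝ.1# ℝ.+ δ
    us-norms = ℝ.trans (ℝ.reflexive (norms-values us)) (norms-excess n (values us) |values|≤n us≈n)

    δ≉0 : ¬ δ ℝ.≈ ℝ.0#
    δ≉0 δ≈0 = u≉1 (All.tabulate⁻ (All.map⁻ (excess-zero n (values us) δ≈0)))

    -- Firing at `x` replaces `n |x|²` by `|x|² (n + δ)`. The gain `|x|² δ` is nonzero because
    -- elements of Γ are.
    fire-≺ : ∀ {c} x d → c ↭ replicate n x ++ d → Norm.total c ≺ Norm.total (map (x G.∙_) us ++ d)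
    fire-≺ {c} x d c↭ = increment-≺
      (ℝ.*-nonNegative (norm-nonNegative _) (excess-nonNegative n (values us)))
      (*-nonZero (λ n≈0 → Γ-nonZero (proj₂ x) (norm-zero (proj₁ x) n≈0)) δ≉0)
      (begin
        Norm.total (map (x G.∙_) us ++ d)
          ≈⟨ Norm.total-++ (map (x G.∙_) us) d ⟩
        Norm.total (map (x G.∙_) us) ℝ.+ D
          ≈⟨ ℝ.+-congʳ (Norm.total-translate x us) ⟩
        N ℝ.* Norm.total us ℝ.+ D
          ≈⟨ ℝ.+-congʳ (ℝ.*-congˡ us-norms) ⟩
        N ℝ.* (n ·ℝ ℝ.1# ℝ.+ δ) ℝ.+ D
          ≈⟨ ℝ.+-congʳ (ℝ.distribˡ N _ _) ⟩
        N ℝ.* n ·ℝ ℝ.1# ℝ.+ N ℝ.* δ ℝ.+ D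
          ≈⟨ ℝ.+-congʳ (ℝ.+-congʳ (ℝ.trans (ℝ×.×-comm-* n N ℝ.1#)
               (ℝ×.×-congʳ n (ℝ.*-identityʳ N)))) ⟩
        n ·ℝ N ℝ.+ N ℝ.* δ ℝ.+ D
          ≈⟨ xy∙z≈xz∙y _ _ _ ⟩
        n ·ℝ N ℝ.+ D ℝ.+ N ℝ.* δ
          ≈⟨ ℝ.+-congʳ (ℝ.+-congʳ (Norm.total-replicate n x)) ⟨
        Norm.total (replicate n x) ℝ.+ D ℝ.+ N ℝ.* δ
          ≈⟨ ℝ.+-congʳ (ℝ.trans (Norm.total-↭ c↭) (Norm.total-++ (replicate n x) d)) ⟨
        Norm.total c ℝ.+ N ℝ.* δ ∎)
      where
      open import Relation.Binary.Reasoning.Setoid ℝ.setoid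
      open CommutativeSemigroupProperties ℝ.+-commutativeSemigroup using (xy∙z≈xz∙y)
      N = norm (proj₁ x)
      D = Norm.total d

    -- Both `h ∑ σ` and `k ∑ σ` are the common nonzero total, so `|h|² = |k|²` and the two
    -- potentials agree.
    shape-⊀ : ∀ {c d h k σ} → c ↭ map (h G.∙_) σ → d ↭ map (k G.∙_) σ →
              total c ≈ total d → ¬ total c ≈ 0# → ¬ Norm.total c ≺ Norm.total d
    shape-⊀ {c} {d} {h} {k} {σ} c↭ d↭ c≈d c≉0 = ≺-irrefl (begin
      Norm.total c                           ≈⟨ Norm.total-↭ c↭ ⟩
      Norm.total (map (h G.∙_) σ)            ≈⟨ Norm.total-translate h σ ⟩
      norm (proj₁ h) ℝ.* Norm.total σ        ≈⟨ ℝ.*-congʳ (*-cancelʳ σ≉0 same) ⟩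
      norm (proj₁ k) ℝ.* Norm.total σ        ≈⟨ Norm.total-translate k σ ⟨
      Norm.total (map (k G.∙_) σ)            ≈⟨ Norm.total-↭ d↭ ⟨
      Norm.total d                           ∎)
      where
      open import Relation.Binary.Reasoning.Setoid ℝ.setoid
      hσ≈c : proj₁ h * total σ ≈ total c
      hσ≈c = sym (trans (total-↭ c↭) (total-translate h σ))
      kσ≈d : proj₁ k * total σ ≈ total d
      kσ≈d = sym (trans (total-↭ d↭) (total-translate k σ))
      σ≉0 : ¬ norm (total σ) ℝ.≈ ℝ.0#
      σ≉0 n≈0 = c≉0 (trans (sym hσ≈c) (trans (*-congˡ (norm-zero (total σ) n≈0)) (zeroʳ _)))
      same : norm (proj₁ h) ℝ.* norm (total σ) ℝ.≈ norm (proj₁ k) ℝ.* norm (total σ)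
      same = begin
        norm (proj₁ h) ℝ.* norm (total σ)  ≈⟨ norm-homo (proj₁ h) (total σ) ⟨
        norm (proj₁ h * total σ)           ≈⟨ norm-cong (trans hσ≈c (trans c≈d (sym kσ≈d))) ⟩
        norm (proj₁ k * total σ)           ≈⟨ norm-homo (proj₁ k) (total σ) ⟩
        norm (proj₁ k) ℝ.* norm (total σ)  ∎

    firingRule : FiringRule W r c ℓ₁ (ℓ₁ ⊔ ℓ₂)
    firingRule = record
      { U = U ; U-ε = R.1∈ ; U-∙ = R.*-closed
      ; n = n ; 1≤n = ℕ.≤-trans (ℕ.≤-trans (s≤s z≤n) 2≤I) I≤n
      ; us = us ; us-U = All.tabulate⁺ (proj₂ ∘ u∈) ; |us|≤n = |us|≤n ; us-total = us-total
      ; order = strictPartialOrder ; potential = Norm.total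
      ; fire-≺ = fire-≺ ; shape-⊀ = shape-⊀ }

    open ChipFiring em firingRule using (Solvable; solvable)
    open Multiplicity em G.setoid
    open Grouping em W

    -- Every chip of the solution is a product `x t` with `x` and `t` in `R`.
    stable-total : ∀ c → All U c → ∃[ s ] total s ≈ total c × All U s × (∀ x → mult x s < n)
    stable-total c c-U = s , total≈ , All.tabulate s-U , stable
      where
      open Solvable (solvable c)
      s-U : ∀ {y} → y ∈ˡ s → U y
      s-U y∈ = let _ , _ , x∈ , t-U , y≈xt = within y∈ in
        R.respects (sym y≈xt) (R.*-closed (All.lookup c-U x∈) t-U)

    -- A negative multiple of a generator is a positive multiple of its negative, which is in Γ
    -- because -1 is.
    combination : ∀ {k} (e : Vector Carrier k) → (∀ i → e i ∈ Γ ∩ R) → (m : Vector ℤ k) →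
                  ∃[ c ] All U c × sum (λ i → m i ·ℤ e i) ≈ total c
    combination {zero}  e e∈ m = [] , [] , refl
    combination {suc k} e e∈ m =
      let c , c-U , c≈ = multiple (m Fin.zero)
          d , d-U , d≈ = combination (e ∘ Fin.suc) (e∈ ∘ Fin.suc) (m ∘ Fin.suc)
      in c ++ d , All.++⁺ c-U d-U , trans (+-cong c≈ d≈) (sym (total-++ c d))
      where
      e₀ = proj₁ (e∈ Fin.zero)
      -e₀ : - e Fin.zero ∈ Γ
      -e₀ = Γ.respects (-1*x≈-x _) (Γ.*-closed -1∈Γ e₀)
      -‿·-distrib : ∀ m x → - (m · x) ≈ m · (- x)
      -‿·-distrib m x = trans (sym (-1*x≈-x _)) (trans (×-comm-* m _ x) (×-congʳ m (-1*x≈-x x)))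
      multiple : ∀ a → ∃[ c ] All U c × a ·ℤ e Fin.zero ≈ total c
      multiple (ℤ.+ a)    = replicate a (_ , e₀) , All.replicate⁺ a (proj₂ (e∈ Fin.zero)) ,
        sym (total-replicate a (_ , e₀))
      multiple -[1+ a ] = replicate (suc a) (_ , -e₀) ,
        All.replicate⁺ (suc a) (R.-‿closed (proj₂ (e∈ Fin.zero))) ,
        trans (-‿·-distrib (suc a) _) (sym (total-replicate (suc a) (_ , -e₀)))

    sum-lookup : ∀ {a} {A : Set a} (f : A → Carrier) xs →
                 sum (f ∘ lookup xs) ≡ foldr _+_ 0# (map f xs)
    sum-lookup f []       = ≡.refl
    sum-lookup f (x ∷ xs) = ≡.cong (f x +_) (sum-lookup f xs)

    representation : ∀ {α} c → All U c → α ≈ total c → ¬ α ≈ 0# →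
                     Σ[ ρ ∈ Representation α ] leading ρ ≤ n ∸ 1
    representation {α} c c-U α≈c α≉0 = build L unique subset decreasing total≈′
      where
      s = proj₁ (stable-total c c-U)
      s≈c = proj₁ (proj₂ (stable-total c c-U))
      s-U = proj₁ (proj₂ (proj₂ (stable-total c c-U)))
      stable = proj₂ (proj₂ (proj₂ (stable-total c c-U)))
      open Grouped (group s)
      total≈′ : α ≈ grouped s L
      total≈′ = trans α≈c (trans (sym s≈c) (sym total≈))
      -- The list is made a variable so that it can be split: if it were empty, α would be zero, and
      -- otherwise its head carries the leading coefficient.
      build : ∀ L → Unique L → All (_∈ˡ s) L →
              (∀ {i j} → i Fin.≤ j → mult (lookup L j) s ≤ mult (lookup L i) s) →
              α ≈ grouped s L → Σ[ ρ ∈ Representation α ] leading ρ ≤ n ∸ 1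
      build [] _ _ _ α≈0 = contradiction α≈0 α≉0
      build L@(x ∷ _) unique subset decreasing α≈ = record
        { a = λ i → mult (lookup L i) s
        ; ν = proj₁ ∘ lookup L
        ; decreasing = decreasing
        ; isUnitSum = record
          { positive = λ i → mult-positive (All.lookup subset (∈-lookup i))
          ; units = λ i → proj₂ (lookup L i) , All.lookup s-U (All.lookup subset (∈-lookup i))
          ; distinct = lookup-injective unique
          ; sums-to = trans α≈ (sym (reflexive (sum-lookup (λ y → mult y s · proj₁ y) L))) } } ,
        -- Stability says `suc (mult x s) ≤ n`; subtracting one gives the bound.
        ℕ.∸-monoˡ-≤ 1 (stable x)

    elementHeight : ∀ {α} c → All U c → α ≈ total c → ∃[ h ] ElementHeight α (fin h)
    elementHeight {α} c c-U α≈c with em {P = α ≈ 0#}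
    ... | yes α≈0 = 0 , ofZero α≈0
    ... | no  α≉0 =
      let ρ , _ = representation c c-U α≈c α≉0
          h , ρ′ , min = least em (λ h → Σ[ ρ ∈ Representation α ] leading ρ ≡ h) (ρ , ≡.refl)
      in h , smallest α≉0 ρ′ λ ρ → min _ (ρ , ≡.refl)

    module _ (combinations : ∀ {α} → α ∈ R → ∃[ c ] All U c × α ≈ total c) where

      height≤ : ∀ {α h} → α ∈ R → ElementHeight α (fin h) → h ≤ n ∸ 1
      height≤ α∈R (ofZero _) = z≤n
      height≤ α∈R (smallest α≉0 _ min) =
        let c , c-U , α≈c = combinations α∈R
            ρ , ρ≤ = representation c c-U α≈c α≉0
        in ℕ.≤-trans (min ρ) ρ≤

      -- All heights are at most `n - 1` and zero has height 0, so a greatest height exists and is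
      -- attained.
      ringHeight : ∃[ h ] RingHeight h × h ≤ʰ fin (n ∸ 1)
      ringHeight =
        let m , attained@(_ , α∈R , αh) , max = greatest em
              (λ m → ∃[ α ] α ∈ R × ElementHeight α (fin m)) (n ∸ 1)
              (0# , R.0∈ , ofZero refl) (λ k (_ , α∈R , αk) → height≤ α∈R αk)
        in fin m , maximum (attained , λ α α∈R →
             let c , c-U , α≈c = combinations α∈R
                 h , αh = elementHeight c c-U α≈c
             in fin h , αh , fin≤fin (max h (α , α∈R , αh))) ,
           fin≤fin (height≤ α∈R αh)

-- The bound on the unit sum height of `R`.

theorem1 : (∀ {a} → ExcludedMiddle a) →
    ∀ {c ℓ₁ ℓ₂ f g r} (ℝ : CompleteOrderedField c ℓ₁ ℓ₂) →
    let open SubsetsOf (complexNumbers ℝ) in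
    (F : Pred Carrier f) → IsSubfield F →
    (Γ : Pred Carrier g) → IsMultiplicativeGroup Γ → Γ ⊆ F ∖0 →
    FinitelyGenerated Γ →
    - 1# ∈ Γ →
    (R : Pred Carrier r) → IsSubring R → R ⊆ F →
    (k : ℕ) (e : Vector Carrier k) → (∀ i → e i ∈ Γ ∩ R) → R ≐ ℤ-span e →
    (n I : ℕ) → 2 ≤ I → I ≤ n →
    (Σ[ u ∈ Vector Carrier I ]
    (∀ i → u i ∈ Γ ∩ R) × sum u ≈ n · 1# × ¬ (∀ i → u i ≈ 1#)) →
    let open UnitSums Γ R in
    (∃[ h ] RingHeight h × h ≤ʰ fin (n ∸ 1)) ×
    (∀ α → α ∈ R → ¬ α ≈ 0# →
    ∃[ l ] Σ[ a ∈ Vector ℕ l ] Σ[ ν ∈ Vector Carrier l ]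
    IsUnitSum α a ν × (∀ i → a i ≤ n ∸ 1))
theorem1 em ℝ F _ Γ Γ-group Γ⊆F∖0 _ -1∈Γ R R-subring _ k e e∈ R≐ℤe n I 2≤I I≤n
         (u , u∈ , u-sum , u≉1) = ringHeight combinations , unitSum
  where
  open SubsetsOf (complexNumbers ℝ)
  open UnitSums Γ R
  open UnitSumRepresentations em ℝ
  open Solution Γ Γ-group (proj₂ ∘ Γ⊆F∖0) -1∈Γ R R-subring
    n I 2≤I I≤n u u∈ u-sum u≉1

  combinations : ∀ {α} → α ∈ R → ∃[ c ] All U c × α ≈ total c
  combinations α∈R =
    let m , α≈ = proj₁ R≐ℤe α∈R
        c , c-U , ≈c = combination e e∈ m
    in c , c-U , trans α≈ ≈c

  unitSum : ∀ α → α ∈ R → ¬ α ≈ 0# →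
            ∃[ l ] Σ[ a ∈ Vector ℕ l ] Σ[ ν ∈ Vector Carrier l ]
              IsUnitSum α a ν × (∀ i → a i ≤ n ∸ 1)
  unitSum α α∈R α≉0 =
    let c , c-U , α≈c = combinations α∈R
        ρ , ρ≤ = representation c c-U α≈c α≉0
    in _ , Representation.a ρ , Representation.ν ρ , Representation.isUnitSum ρ ,
       -- The coefficients decrease, so the bound on the leading one covers them all.
       λ i → ℕ.≤-trans (Representation.decreasing ρ z≤n) ρ≤
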